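{- Let $\Sigma=(N_C,N_R)$ be a signature and let $\mathcal{I}$ be a finite $\Sigma$-model such that for all distinct $a,b\in\Delta^{\mathcal{I}}$: if $N_C^{\mathcal{I}}(a)=N_C^{\mathcal{I}}(b)$ then there exists $r\in N_R$ with $a\in r_1^{\mathcal{I}}$ and $b\notin r_1^{\mathcal{I}}$. Then for every subset $S\subseteq\Delta^{\mathcal{I}}$, the concept $C_S$ calculated by the procedure described in the context (whatever choices are made in it) satisfies $C_S^{\mathcal{I}}=S$.
   Context: A signature $\Sigma=(N_C,N_R)$ consists of a set $N_C$ of concept names and a set $N_R$ of role names. The set $\mathcal{EC}(\Sigma)$ of concept descriptions (description logic $\mathcal{ALC}$) is inductively generated by: $\bot,\top$; every $c\in N_C$; $C\sqcup D$, $C\sqcap D$, $C^c$ for $C,D\in\mathcal{EC}(\Sigma)$; $\forall r.C$, $\exists r.C$ for $C\in\mathcal{EC}(\Sigma)$, $r\in N_R$. A $\Sigma$-model $\mathcal{I}$ consists of a non-empty set $\Delta^{\mathcal{I}}$ (the carrier), a subset $c^{\mathcal{I}}\subseteq\Delta^{\mathcal{I}}$ for each $c\in N_C$ and a binary relation $r^{\mathcal{I}}\subseteq\Delta^{\mathcal{I}}\times\Delta^{\mathcal{I}}$ for each $r\in N_R$; it is finite if its carrier is. The evaluation $C^{\mathcal{I}}\subseteq\Delta^{\mathcal{I}}$ of a concept description is defined by: $\top^{\mathcal{I}}=\Delta^{\mathcal{I}}$, $\bot^{\mathcal{I}}=\emptyset$, concept names are evaluated as given, $\sqcup,\sqcap$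 are union and intersection, $(C^c)^{\mathcal{I}}=\Delta^{\mathcal{I}}\setminus C^{\mathcal{I}}$, $(\forall r.C)^{\mathcal{I}}=\{x\mid \forall y,\ (x,y)\in r^{\mathcal{I}}\Rightarrow y\in C^{\mathcal{I}}\}$, $(\exists r.C)^{\mathcal{I}}=\{x\mid \exists y,\ (x,y)\in r^{\mathcal{I}}\text{ and } y\in C^{\mathcal{I}}\}$. Notation: for $r\in N_R$, $r_1^{\mathcal{I}}=\{a\in\Delta^{\mathcal{I}}\mid\exists b\in\Delta^{\mathcal{I}},(a,b)\in r^{\mathcal{I}}\}$; for $a\in\Delta^{\mathcal{I}}$, $N_C^{\mathcal{I}}(a)=\{c\in N_C\mid a\in c^{\mathcal{I}}\}$. Procedure computing a concept description $C_S$ for each $S\subseteq\Delta^{\mathcal{I}}$: - For $S=\emptyset$, $C_S=\bot$. - For $S=\{a\}$: (i) if $N_C^{\mathcal{I}}(a)\neq\emptyset$, choose $c\in N_C^{\mathcal{I}}(a)$ and set $C_a=c$; otherwise choose any $c\in N_C$ and set $C_a=c^c$. (ii) For every $b\in\Delta^{\mathcal{I}}$ with $b\neq a$, define $C_{b/a}$: if $N_C^{\mathcal{I}}(a)\neq N_C^{\mathcal{I}}(b)$, choose $c\in N_C^{\mathcal{I}}(b)\setminus N_C^{\mathcal{I}}(a)$ and set $C_{b/a}=c$; otherwise choose $r\in N_R$ with $b\in r_1^{\mathcal{I}}$ and $a\notin r_1^{\mathcal{I}}$ and set $C_{b/a}=\exists r.\top$. Then set $C_{\{a\}}=C_a\sqcap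 (C_{b_1/a})^c\sqcap\cdots\sqcap (C_{b_m/a})^c$, where $b_1,\ldots,b_m$ enumerate all the elements $b\in C_a^{\mathcal{I}}$ with $b\neq a$ (so $C_{\{a\}}=C_a$ if there are none). - For $S=\{a_1,\ldots,a_n\}$, $C_S=\bigsqcup_{a_i\in S}C_{\{a_i\}}$.
   Formalization: The procedure can get stuck (if N_C(b) is a proper subset of N_C(a), no c in N_C(b)\N_C(a) exists), leaving C_S undefined; the formal theorem states C_S^I = S for every concept resulting from a completed run and does not claim that a run can be completed. -}

module Defs where

open import Data.Fin.Base using (Fin)
open import Data.List.Base using (List; _∷_; foldl; map)
open import Data.List.Membership.Propositional using () renaming (_∈_ to _∈ˡ_)
open import Data.List.Relation.Unary.Unique.Propositional using (Unique)
open import Data.Product.Base using (_×_; ∃-syntax)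
open import Function.Base using (_∘_)
open import Function.Bundles using (_↔_; _⇔_)
open import Level using (0ℓ)
open import Relation.Binary.Core using (Rel)
open import Relation.Nullary.Negation.Core using (¬_)
open import Relation.Unary
  using (Pred; _∈_; _∉_; _≐_; _∪_; _∩_; _∖_; ∁; U; ∅; ｛_｝; Empty)

record Signature : Set₁ where
  field
    ConceptName : Set
    RoleName    : Set

open Signature public

infix  9 _ᶜ
infixr 8 ∀⟨_⟩_ ∃⟨_⟩_
infixl 7 _⊓_
infixl 6 _⊔_

data Concept (Σ : Signature) : Set where
  ⊥ ⊤     : Concept Σ
  name    : ConceptName Σ → Concept Σ
  _⊔_ _⊓_ : Concept Σ → Concept Σ → Concept Σ
  _ᶜ      : Concept Σ → Concept Σ
  ∀⟨_⟩_   : RoleName Σ → Concept Σ → Concept Σ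
  ∃⟨_⟩_   : RoleName Σ → Concept Σ → Concept Σ

record Model (Σ : Signature) : Set₁ where
  field
    Carrier  : Set
    nonEmpty : Carrier
    nameᴵ    : ConceptName Σ → Pred Carrier 0ℓ
    roleᴵ    : RoleName Σ → Rel Carrier 0ℓ

module _ {Σ : Signature} (𝓘 : Model Σ) where
  open Model 𝓘

  Finite : Set
  Finite = ∃[ n ] (Fin n ↔ Carrier)

  ⟦_⟧ : Concept Σ → Pred Carrier 0ℓ
  ⟦ ⊥ ⟧        = ∅
  ⟦ ⊤ ⟧        = U
  ⟦ name c ⟧   = nameᴵ c
  ⟦ C ⊔ D ⟧    = ⟦ C ⟧ ∪ ⟦ D ⟧
  ⟦ C ⊓ D ⟧    = ⟦ C ⟧ ∩ ⟦ D ⟧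
  ⟦ C ᶜ ⟧      = ∁ ⟦ C ⟧
  ⟦ ∀⟨ r ⟩ C ⟧ = λ x → ∀ y → roleᴵ r x y → y ∈ ⟦ C ⟧
  ⟦ ∃⟨ r ⟩ C ⟧ = λ x → ∃[ y ] (roleᴵ r x y × y ∈ ⟦ C ⟧)

  -- r₁ᴵ
  dom : RoleName Σ → Pred Carrier 0ℓ
  dom r a = ∃[ b ] roleᴵ r a b

  -- N_Cᴵ(a)
  names : Carrier → Pred (ConceptName Σ) 0ℓ
  names a c = a ∈ nameᴵ c

  Enumerates : List Carrier → Pred Carrier 0ℓ → Set
  Enumerates xs P = Unique xs × (∀ x → x ∈ˡ xs ⇔ x ∈ P)

  -- The procedure is nondeterministic, so each of its stages is the relation
  -- "this concept is a possible result".  A stage at which the required choice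
  -- cannot be made has no result.

  -- Possible values of C_a.
  data Initial (a : Carrier) : Concept Σ → Set where
    positive : ∀ {c} → c ∈ names a → Initial a (name c)
    negative : ∀ {c} → Empty (names a) → Initial a (name c ᶜ)

  -- Possible values of C_{b/a}.
  data Separator (b a : Carrier) : Concept Σ → Set where
    byName : ∀ {c} → ¬ (names a ≐ names b) →
             c ∈ names b ∖ names a → Separator b a (name c)
    byRole : ∀ {r} → names a ≐ names b →
             b ∈ dom r → a ∉ dom r → Separator b a (∃⟨ r ⟩ ⊤)

  -- Possible values of C_{{a}}.  Only the C_{b/a} that occur in the resulting
  -- concept have to exist; sep is arbitrary at all other b.
  data SingletonResult (a : Carrier) : Concept Σ → Set where
    singletonResult :
      ∀ {Cₐ} → Initial a Cₐ →
      (bs : List Carrier) → Enumerates bs (⟦ Cₐ ⟧ ∖ ｛ a ｝) →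
      (sep : Carrier → Concept Σ) → (∀ {b} → b ∈ˡ bs → Separator b a (sep b)) →
      SingletonResult a (foldl _⊓_ Cₐ (map (_ᶜ ∘ sep) bs))

  -- Possible values of C_S.  The last clause also covers one-element lists,
  -- where it agrees with the second.
  data Result (S : Pred Carrier 0ℓ) : Concept Σ → Set where
    empty     : Empty S → Result S ⊥
    singleton : ∀ {a C} → S ≐ ｛ a ｝ → SingletonResult a C → Result S C
    union     :
      (a : Carrier) (as : List Carrier) → Enumerates (a ∷ as) S →
      (D : Carrier → Concept Σ) → (∀ {x} → x ∈ S → SingletonResult x (D x)) →
      Result S (foldl _⊔_ (D a) (map D as))

{-# OPTIONS --safe #-}

-- The hypothesis on roles makes the choices in the procedure possible; given
-- those choices, C_{b/a} contains b but not a.  So each conjunct (C_{b/a})ᶜ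
-- keeps a and removes b, and C_{{a}} removes every element of C_a other than a.
-- Constructively this only gives ¬ ¬ (x ≡ a) for an element x of C_{{a}};
-- finiteness makes equality on the carrier decidable and hence stable.

module Submission where

open import Defs
open import Data.Fin.Properties using (inj⇒≟)
open import Data.List.Base using ([]; _∷_; foldl; map)
open import Data.List.Membership.Propositional using (find; lose)
open import Data.List.Relation.Unary.All using (All; []; _∷_; lookup; tabulate)
open import Data.List.Relation.Unary.All.Properties using (map⁺; map⁻)
open import Data.List.Relation.Unary.Any using (Any; here; there; toSum; fromSum)
import Data.List.Relation.Unary.Any.Properties as Any
open import Data.Product.Base using (_×_; _,_; ∃-syntax)
open import Data.Sum.Base using (_⊎_; inj₁; inj₂)
open import Data.Unit.Base using (tt)
open import Function.Bundles using (Equivalence)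
open import Function.Properties.Inverse using (↔-sym; ↔⇒↣)
open import Level using (0ℓ)
open import Relation.Binary.Definitions using (DecidableEquality)
open import Relation.Binary.PropositionalEquality.Core using (_≢_; refl)
open import Relation.Nullary.Decidable.Core using (decidable-stable)
open import Relation.Unary using (Pred; _∈_; _∉_; _≐_; ｛_｝)
open import Relation.Unary.Properties using (≐-sym; ≐-trans)

finite⇒≟ : {Σ : Signature} (𝓘 : Model Σ) → Finite 𝓘 →
           DecidableEquality (Model.Carrier 𝓘)
finite⇒≟ 𝓘 (_ , Fin↔Carrier) = inj⇒≟ (↔⇒↣ (↔-sym Fin↔Carrier))

module _ {Σ : Signature} (𝓘 : Model Σ) where
  open Model 𝓘

  -- `foldl` moves each head into the accumulator, so this and the next three lemmas leave `C`
  -- arbitrary for the induction on `Ds`.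
  foldl-⊓⁺ : ∀ {x C} Ds → x ∈ ⟦ 𝓘 ⟧ C → All (λ D → x ∈ ⟦ 𝓘 ⟧ D) Ds →
             x ∈ ⟦ 𝓘 ⟧ (foldl _⊓_ C Ds)
  foldl-⊓⁺ []       x∈C []           = x∈C
  foldl-⊓⁺ (D ∷ Ds) x∈C (x∈D ∷ x∈Ds) = foldl-⊓⁺ Ds (x∈C , x∈D) x∈Ds

  foldl-⊓⁻ : ∀ {x C} Ds → x ∈ ⟦ 𝓘 ⟧ (foldl _⊓_ C Ds) →
             x ∈ ⟦ 𝓘 ⟧ C × All (λ D → x ∈ ⟦ 𝓘 ⟧ D) Ds
  foldl-⊓⁻ []       x∈C = x∈C , []
  foldl-⊓⁻ (D ∷ Ds) x∈  with foldl-⊓⁻ Ds x∈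
  ... | (x∈C , x∈D) , x∈Ds = x∈C , x∈D ∷ x∈Ds

  foldl-⊔⁺ : ∀ {x C} Ds → x ∈ ⟦ 𝓘 ⟧ C ⊎ Any (λ D → x ∈ ⟦ 𝓘 ⟧ D) Ds →
             x ∈ ⟦ 𝓘 ⟧ (foldl _⊔_ C Ds)
  foldl-⊔⁺ []       (inj₁ x∈C)          = x∈C
  foldl-⊔⁺ (D ∷ Ds) (inj₁ x∈C)          = foldl-⊔⁺ Ds (inj₁ (inj₁ x∈C))
  foldl-⊔⁺ (D ∷ Ds) (inj₂ (here x∈D))   = foldl-⊔⁺ Ds (inj₁ (inj₂ x∈D))
  foldl-⊔⁺ (D ∷ Ds) (inj₂ (there x∈Ds)) = foldl-⊔⁺ Ds (inj₂ x∈Ds)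

  foldl-⊔⁻ : ∀ {x C} Ds → x ∈ ⟦ 𝓘 ⟧ (foldl _⊔_ C Ds) →
             x ∈ ⟦ 𝓘 ⟧ C ⊎ Any (λ D → x ∈ ⟦ 𝓘 ⟧ D) Ds
  foldl-⊔⁻ []       x∈C = inj₁ x∈C
  foldl-⊔⁻ (D ∷ Ds) x∈  with foldl-⊔⁻ Ds x∈
  ... | inj₁ (inj₁ x∈C) = inj₁ x∈C
  ... | inj₁ (inj₂ x∈D) = inj₂ (here x∈D)
  ... | inj₂ x∈Ds       = inj₂ (there x∈Ds)

  initial-∈ : ∀ {a C} → Initial 𝓘 a C → a ∈ ⟦ 𝓘 ⟧ C
  initial-∈ (positive c∈a) = c∈a
  -- No name holds at `a`, so the complement of whichever name was chosen contains `a`.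
  initial-∈ (negative ∅a)  = ∅a _

  -- `∃⟨ r ⟩ ⊤` denotes `dom r` up to the trivial membership in `⊤`, so in both cases the condition
  -- on the choice is already the claim.
  separator-∈ : ∀ {a b C} → Separator 𝓘 b a C → b ∈ ⟦ 𝓘 ⟧ C
  separator-∈ (byName _ (c∈b , _))   = c∈b
  separator-∈ (byRole _ (y , rby) _) = y , rby , tt

  separator-∉ : ∀ {a b C} → Separator 𝓘 b a C → a ∉ ⟦ 𝓘 ⟧ C
  separator-∉ (byName _ (_ , c∉a)) a∈c           = c∉a a∈c
  separator-∉ (byRole _ _ a∉r)     (y , ray , _) = a∉r (y , ray)

  singletonResult-≐ : DecidableEquality Carrier →
    ∀ {a C} → SingletonResult 𝓘 a C → ⟦ 𝓘 ⟧ C ≐ ｛ a ｝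
  singletonResult-≐ _≟_ {a} (singletonResult {Cₐ} init bs (_ , enum) sep isSep) =
    (λ {x} x∈ → let x∈Cₐ , x∉seps = foldl-⊓⁻ (map (λ b → sep b ᶜ) bs) x∈ in
      decidable-stable (a ≟ x) λ a≢x →
        -- `bs` exhausts `Cₐ` without `a`, so `x` would be listed there; the conjunct at `b = x`
        -- then excludes `x` from `sep x`, which contains it.
        let x∈bs = Equivalence.from (enum x) (x∈Cₐ , a≢x) in
        lookup (map⁻ x∉seps) x∈bs (separator-∈ (isSep x∈bs))) ,
    λ { refl → foldl-⊓⁺ (map (λ b → sep b ᶜ) bs) (initial-∈ init)
                 (map⁺ (tabulate λ b∈bs → separator-∉ (isSep b∈bs))) }

  result-≐ : DecidableEquality Carrier →
    ∀ {S C} → Result 𝓘 S C → ⟦ 𝓘 ⟧ C ≐ S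
  result-≐ _≟_ (empty ∅S) = (λ ()) , λ {x} → ∅S x
  result-≐ _≟_ (singleton S≐a res) =
    ≐-trans (singletonResult-≐ _≟_ res) (≐-sym S≐a)
  result-≐ _≟_ {S} (union a as (_ , enum) D res) = sound , complete
    where
    D≐ : ∀ {x} → x ∈ S → ⟦ 𝓘 ⟧ (D x) ≐ ｛ x ｝
    D≐ x∈S = singletonResult-≐ _≟_ (res x∈S)

    sound : ∀ {x} → x ∈ ⟦ 𝓘 ⟧ (foldl _⊔_ (D a) (map D as)) → x ∈ S
    sound x∈ with find (Any.map⁻ {f = D} {xs = a ∷ as} (fromSum (foldl-⊔⁻ (map D as) x∈)))
    ... | b , b∈as , x∈Db with Equivalence.to (enum b) b∈as
    ...   | b∈S with D≐ b∈S
    -- `D b` denotes the singleton of `b`, which forces `x` to be `b`.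
    ...     | Db⊆b , _ with Db⊆b x∈Db
    ...       | refl = b∈S

    complete : ∀ {x} → x ∈ S → x ∈ ⟦ 𝓘 ⟧ (foldl _⊔_ (D a) (map D as))
    complete {x} x∈S with D≐ x∈S
    -- The enumeration lists `x` itself, so the disjunct `D x` is the one that contains it.
    ... | _ , x⊆Dx = foldl-⊔⁺ (map D as)
      (toSum (Any.map⁺ (lose (Equivalence.from (enum x) x∈S) (x⊆Dx refl))))

theorem4 : (Σ : Signature) (𝓘 : Model Σ) → Finite 𝓘 →
    (∀ a b → a ≢ b → names 𝓘 a ≐ names 𝓘 b →
    ∃[ r ] (a ∈ dom 𝓘 r × b ∉ dom 𝓘 r)) →
    (S : Pred (Model.Carrier 𝓘) 0ℓ) (C : Concept Σ) →
    Result 𝓘 S C → ⟦_⟧ 𝓘 C ≐ S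
theorem4 Σ 𝓘 fin _ S C res = result-≐ 𝓘 (finite⇒≟ 𝓘 fin) res
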